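{- A connected outer 1-planar graph $G$ is cop-win if and only if $G$ is chordal.
   Context: A graph is outer 1-planar if it can be drawn in the plane with all vertices in convex position on the outer boundary and each edge crossed at most once (drawings are simple). Cops and Robbers: cops are placed on vertices first, then the robber; players alternate turns, cops each moving along an edge or staying, robber moving along an edge or staying; full information; the cops win if a cop occupies the robber's vertex. A graph is cop-win if a single cop can always catch the robber. A graph is chordal if it has no induced cycle of length at least four. -}

module Defs where

open import Data.Nat using (ℕ; suc; _+_; _%_)
open import Data.Fin using (Fin; toℕ; _<_)
open import Data.Bool using (Bool; T)
open import Data.Product using (Σ; _×_; _,_; ∃)
open import Data.Sum using (_⊎_)
open import Data.Empty using (⊥)
open import Function.Definitions using (Injective)
open import Relation.Nullary using (¬_)
open import Relation.Binary.PropositionalEquality using (_≡_; _≢_)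

record Graph : Set where
  field
    n     : ℕ
    adj   : Fin n → Fin n → Bool
    sym   : ∀ x y → T (adj x y) → T (adj y x)
    irrfl : ∀ x → ¬ T (adj x x)

module _ (G : Graph) where
  open Graph G

  Adj : Fin n → Fin n → Set
  Adj x y = T (adj x y)

  Move : Fin n → Fin n → Set
  Move x y = x ≡ y ⊎ Adj x y

  -- Connectivity (a connected graph is nonempty)
  data Reach : Fin n → Fin n → Set where
    here : ∀ {x} → Reach x x
    step : ∀ {x y z} → Adj x y → Reach y z → Reach x z

  Connected : Set
  Connected = Fin n × (∀ x y → Reach x y)

  CycNext : ∀ {k} → Fin (4 + k) → Fin (4 + k) → Set
  CycNext {k} i j = suc (toℕ i) % (4 + k) ≡ toℕ j

  InducedCycle : ℕ → Set
  InducedCycle k =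
    Σ (Fin (4 + k) → Fin n) λ v →
      Injective _≡_ _≡_ v ×
      (∀ i j → (Adj (v i) (v j) → CycNext i j ⊎ CycNext j i) ×
               (CycNext i j ⊎ CycNext j i → Adj (v i) (v j)))

  Chordal : Set
  Chordal = ∀ k → ¬ InducedCycle k

  -- Outer 1-planarity. Vertices are placed in convex position (on a circle)
  -- in the cyclic order given by an injective position map pos. In a simple
  -- drawing with all vertices on the outer face, two edges uv, wx cross
  -- exactly when their endpoints interleave along the circle.
  module _ (pos : Fin n → Fin n) where
    Betw : Fin n → Fin n → Fin n → Set
    Betw a b c = (pos a < pos c × pos c < pos b) ⊎ (pos b < pos c × pos c < pos a)

    Outside : Fin n → Fin n → Fin n → Set
    Outside a b c = ¬ Betw a b c × c ≢ a × c ≢ b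

    Cross : Fin n → Fin n → Fin n → Fin n → Set
    Cross u v w x = (Betw u v w × Outside u v x) ⊎ (Outside u v w × Betw u v x)

    SameEdge : Fin n → Fin n → Fin n → Fin n → Set
    SameEdge w x y z = (w ≡ y × x ≡ z) ⊎ (w ≡ z × x ≡ y)

    AtMostOneCrossing : Set
    AtMostOneCrossing =
      ∀ u v w x y z → Adj u v → Adj w x → Adj y z →
        Cross u v w x → Cross u v y z → SameEdge w x y z

  Outer1Planar : Set
  Outer1Planar = Σ (Fin n → Fin n) λ pos → Injective _≡_ _≡_ pos × AtMostOneCrossing pos

  -- Cops and Robbers with one cop.
  -- CopWins c r : cop on c, robber on r, robber to move; the cop can force
  -- capture in finitely many rounds (inductive = well-founded game tree).
  data CopWins : Fin n → Fin n → Set where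
    caught : ∀ {c r} → c ≡ r → CopWins c r
    round  : ∀ {c r} → c ≢ r →
             (∀ r' → Move r r' → Σ (Fin n) λ c' → Move c c' × CopWins c' r') →
             CopWins c r

  CopWin : Set
  CopWin = Σ (Fin n) λ c → ∀ r → Σ (Fin n) λ c' → Move c c' × CopWins c' r

{-# OPTIONS --safe #-}
module Submission where

-- Write N[x] for the closed neighbourhood of x. If N[u] ∩ S ⊆ N[v] for some v ≠ u in S, then
-- folding u onto v retracts S onto S ∖ u. For a chordal graph such folds lead to a single
-- vertex, as Dirac's theorem provides a simplicial u and connectivity a neighbour v of it;
-- the cop catches the successive shadows of the robber.
--
-- Conversely, if G has a hole, its vertices form a rigid set W: no vertex of W is simplicial
-- in W. Fold as long as a retract S ⊇ W admits a fold. If S ∖ u contains no rigid set any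
-- more, Dirac's theorem shows that v is adjacent to all of W ∖ v, which is still rigid: a wheel
-- with hub v. On a retract without folds the robber always has a move away from the shadow
-- of the cop.
--
-- Wheels with hub h are not outer 1-planar: let p be the first rim vertex after h on the circle,
-- s and t its nonadjacent neighbours in this order, q ≠ p another neighbour of s. The edge pt
-- crosses hs, and it crosses sq or hq as well.

open import Defs
open import Data.Bool.Properties using (T?)
open import Data.Empty using (⊥; ⊥-elim)
open import Data.Fin using (Fin; zero; suc; toℕ; fromℕ; fromℕ<; inject₁; _<_)
open import Data.Fin.Induction using (spo-wellFounded)
open import Data.Fin.Properties using (_≟_; any?; toℕ-injective; toℕ-fromℕ; toℕ-fromℕ<;
  toℕ-inject₁; toℕ<n; _<?_; <-cmp; <-trans; <-asym)
open import Data.Fin.Subset using (Subset; _∈_; _⊆_; _⊂_; _⊃_) renaming (⊤ to full)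
open import Data.Fin.Subset.Induction using (Acc; acc; ⊂-wellFounded; ⊃-wellFounded)
open import Data.Fin.Subset.Properties using (_∈?_; ∈⊤)
open import Data.Nat as ℕ using (ℕ; zero; suc; _+_; _%_; s≤s)
import Data.Nat.Properties as ℕₚ
open import Data.Nat.DivMod using (m<n⇒m%n≡m; n%n≡0)
open import Data.Product using (Σ; ∃; ∃-syntax; _×_; _,_; proj₁; proj₂)
open import Data.Sum using (_⊎_; inj₁; inj₂; [_,_]′; swap)
open import Data.Vec using (tabulate)
open import Data.Vec.Functional using (_∷_)
open import Data.Unit using (⊤; tt)
open import Data.Vec.Properties using (lookup∘tabulate; []=⇒lookup; lookup⇒[]=)
open import Function using (_∘_; id)
open import Relation.Binary using (Rel; IsStrictPartialOrder; tri<; tri≈; tri>)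
open import Relation.Binary.Construct.Closure.ReflexiveTransitive using (Star; ε; _◅_; _◅◅_; gmap; reverse)
open import Relation.Binary.PropositionalEquality using (_≡_; _≢_; refl; sym; trans; cong; subst; isEquivalence)
open import Relation.Nullary using (Dec; yes; no; ¬_; does; contradiction)
open import Relation.Nullary.Decidable using (dec-true; ¬?; _×-dec_; _⊎-dec_; decidable-stable)
open import Relation.Unary using (Pred; Decidable)
import Level

-- Subsets cut out by decidable predicates, and reachability

module _ {n : ℕ} {P : Pred (Fin n) Level.zero} (P? : Decidable P) where

  ⟪_⟫ : Subset n
  ⟪_⟫ = tabulate (does ∘ P?)

  ∈⟪⟫⁺ : ∀ {x} → P x → x ∈ ⟪_⟫
  ∈⟪⟫⁺ {x} p = lookup⇒[]= x _ (trans (lookup∘tabulate _ x) (dec-true (P? x) p))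

  ∈⟪⟫⁻ : ∀ {x} → x ∈ ⟪_⟫ → P x
  ∈⟪⟫⁻ {x} x∈ with P? x | trans (sym (lookup∘tabulate (does ∘ P?) x)) ([]=⇒lookup x∈)
  ... | yes p | _ = p

module _ {n : ℕ} where

  infixl 6 _∖_

  remains? : ∀ (S : Subset n) u → Decidable (λ x → x ∈ S × x ≢ u)
  remains? S u x = (x ∈? S) ×-dec ¬? (x ≟ u)

  _∖_ : Subset n → Fin n → Subset n
  S ∖ u = ⟪ remains? S u ⟫

  ∈∖⁺ : ∀ {S u x} → x ∈ S → x ≢ u → x ∈ S ∖ u
  ∈∖⁺ {S} {u} x∈S x≢u = ∈⟪⟫⁺ (remains? S u) (x∈S , x≢u)

  ∈∖⁻ : ∀ {S u x} → x ∈ S ∖ u → x ∈ S × x ≢ u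
  ∈∖⁻ {S} {u} = ∈⟪⟫⁻ (remains? S u)

  ∖-⊂ : ∀ {S u} → u ∈ S → S ∖ u ⊂ S
  ∖-⊂ u∈S = (λ x∈ → proj₁ (∈∖⁻ x∈)) , _ , u∈S , λ u∈ → proj₂ (∈∖⁻ u∈) refl

  ReachableSet : Rel (Fin n) Level.zero → Fin n → Set
  ReachableSet R d = Σ (Subset n) λ D →
    d ∈ D × (∀ {x} → x ∈ D → Star R d x) × (∀ {x y} → x ∈ D → R x y → y ∈ D)

  reachableSet : ∀ {R} → (∀ x y → Dec (R x y)) → ∀ d → ReachableSet R d
  reachableSet {R} R? d =
    grow (⊃-wellFounded _) (∈⟪⟫⁺ (_≟ d) refl) λ x∈ → start (∈⟪⟫⁻ (_≟ d) x∈)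
    where
    start : ∀ {x} → x ≡ d → Star R d x
    start refl = ε

    grow : ∀ {D} → Acc _⊃_ D → d ∈ D → (∀ {x} → x ∈ D → Star R d x) → ReachableSet R d
    grow {D} (acc larger) d∈D reach
      with any? (λ x → any? (λ y → (x ∈? D) ×-dec R? x y ×-dec ¬? (y ∈? D)))
    ... | no closed = D , d∈D , reach , λ {x} {y} x∈D xRy →
          decidable-stable (y ∈? D) λ y∉D → closed (x , y , x∈D , xRy , y∉D)
    ... | yes (x , y , x∈D , xRy , y∉D) =
          grow (larger ((λ z∈D → ∈⟪⟫⁺ D+y? (inj₁ z∈D)) , y , ∈⟪⟫⁺ D+y? (inj₂ refl) , y∉D))
               (∈⟪⟫⁺ D+y? (inj₁ d∈D)) (λ z∈ → reach′ (∈⟪⟫⁻ D+y? z∈))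
      where
      D+y? : Decidable (λ z → z ∈ D ⊎ z ≡ y)
      D+y? z = (z ∈? D) ⊎-dec (z ≟ y)

      reach′ : ∀ {z} → z ∈ D ⊎ z ≡ y → Star R d z
      reach′ (inj₁ z∈D)  = reach z∈D
      reach′ (inj₂ refl) = reach x∈D ◅◅ (xRy ◅ ε)

-- Closed neighbourhoods, simplicial vertices, rigid sets

module _ (G : Graph) where
  open Graph G using (n; irrfl) renaming (sym to adj-sym)

  infix 4 _~_ _≃_

  _~_ _≃_ : Fin n → Fin n → Set
  _~_ = Adj G
  _≃_ = Move G

  V : Set
  V = Fin n

  _~?_ : ∀ x y → Dec (x ~ y)
  x ~? y = T? _

  _≃?_ : ∀ x y → Dec (x ≃ y)
  x ≃? y = (x ≟ y) ⊎-dec (x ~? y)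

  ~-sym : ∀ {x y} → x ~ y → y ~ x
  ~-sym = adj-sym _ _

  ≃-sym : ∀ {x y} → x ≃ y → y ≃ x
  ≃-sym (inj₁ refl) = inj₁ refl
  ≃-sym (inj₂ x~y)  = inj₂ (~-sym x~y)

  ~⇒≢ : ∀ {x y} → x ~ y → x ≢ y
  ~⇒≢ x~x refl = irrfl _ x~x

  ≃∧≢⇒~ : ∀ {x y} → x ≃ y → x ≢ y → x ~ y
  ≃∧≢⇒~ (inj₁ x≡y) x≢y = contradiction x≡y x≢y
  ≃∧≢⇒~ (inj₂ x~y) _   = x~y

  Simplicial : Subset n → V → Set
  Simplicial T z = ∀ {s t} → s ∈ T → t ∈ T → z ~ s → z ~ t → s ≃ t

  -- Nonemptiness is demanded because the empty set would satisfy the rest vacuously.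
  Rigid : Subset n → Set
  Rigid W = ∃ (_∈ W) × (∀ {x} → x ∈ W →
    ∃[ s ] ∃[ t ] s ∈ W × t ∈ W × x ~ s × x ~ t × ¬ s ≃ t)

  HoleIn : Subset n → Set
  HoleIn T = ∃[ k ] Σ (InducedCycle G k) λ c → ∀ i → proj₁ c i ∈ T

  HoleIn-mono : ∀ {S T} → S ⊆ T → HoleIn S → HoleIn T
  HoleIn-mono S⊆T (k , c , c∈S) = k , c , S⊆T ∘ c∈S

  -- Holes and induced paths

  -- `CycNext` with the remainder resolved, so that the wrap from the last index to 0 can be matched
  -- on.
  Next : ∀ {k} → Fin (4 + k) → Fin (4 + k) → Set
  Next {k} i j = suc (toℕ i) ≡ toℕ j ⊎ (suc (toℕ i) ≡ 4 + k × toℕ j ≡ 0)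

  CycNext⇒Next : ∀ {k} {i j : Fin (4 + k)} → CycNext G i j → Next i j
  CycNext⇒Next {k} {i} {j} eq with ℕₚ.m≤n⇒m<n∨m≡n (toℕ<n i)
  ... | inj₁ 1+i<4+k = inj₁ (trans (sym (m<n⇒m%n≡m 1+i<4+k)) eq)
  ... | inj₂ 1+i≡4+k = inj₂ (1+i≡4+k ,
        trans (sym eq) (trans (cong (_% (4 + k)) 1+i≡4+k) (n%n≡0 (4 + k))))

  Next⇒CycNext : ∀ {k} {i j : Fin (4 + k)} → Next i j → CycNext G i j
  Next⇒CycNext {k} {i} {j} (inj₁ eq) =
    trans (m<n⇒m%n≡m (subst (ℕ._< 4 + k) (sym eq) (toℕ<n j))) eq
  Next⇒CycNext {k} (inj₂ (1+i≡4+k , j≡0)) =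
    trans (cong (_% (4 + k)) 1+i≡4+k) (trans (n%n≡0 (4 + k)) (sym j≡0))

  successor : ∀ {k} (i : Fin (4 + k)) → ∃ (Next i)
  successor {k} i with ℕₚ.m≤n⇒m<n∨m≡n (toℕ<n i)
  ... | inj₁ 1+i<4+k = fromℕ< 1+i<4+k , inj₁ (sym (toℕ-fromℕ< 1+i<4+k))
  ... | inj₂ 1+i≡4+k = zero , inj₂ (1+i≡4+k , refl)

  predecessor : ∀ {k} (i : Fin (4 + k)) → ∃[ l ] Next l i
  predecessor {k} zero = fromℕ (3 + k) , inj₂ (cong suc (toℕ-fromℕ (3 + k)) , refl)
  predecessor (suc i)  = inject₁ i , inj₁ (cong suc (toℕ-inject₁ i))

  no-2-cycle : ∀ {k} {i j : Fin (4 + k)} → Next i j → ¬ Next j i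
  no-2-cycle {i = i} {j} p q = arith (toℕ i) (toℕ j) p q
    where
    arith : ∀ {k} a b → suc a ≡ b ⊎ (suc a ≡ 4 + k × b ≡ 0) →
            ¬ (suc b ≡ a ⊎ (suc b ≡ 4 + k × a ≡ 0))
    arith a _ (inj₁ refl) (inj₁ e) = ℕₚ.m≢1+n+m a {1} (sym e)
    arith .0 _ (inj₁ refl) (inj₂ (() , refl))
    arith .1 _ (inj₂ (() , refl)) (inj₁ refl)
    arith _ _ (inj₂ (() , refl)) (inj₂ (_ , refl))

  -- The critical case 0, 1, 2 and back would need `3 ≡ 4 + k`: a triangle is no hole.
  no-3-cycle : ∀ {k} {i j l : Fin (4 + k)} → Next i j → Next j l → ¬ Next l i
  no-3-cycle {i = i} {j} {l} p q r = arith (toℕ i) (toℕ j) (toℕ l) p q r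
    where
    arith : ∀ {k} a b c → suc a ≡ b ⊎ (suc a ≡ 4 + k × b ≡ 0) →
            suc b ≡ c ⊎ (suc b ≡ 4 + k × c ≡ 0) → ¬ (suc c ≡ a ⊎ (suc c ≡ 4 + k × a ≡ 0))
    arith a _ _ (inj₁ refl) (inj₁ refl) (inj₁ e) = ℕₚ.m≢1+n+m a {2} (sym e)
    arith _ _ _ (inj₁ refl) (inj₁ refl) (inj₂ (() , refl))
    arith _ _ _ (inj₁ refl) (inj₂ (() , refl)) (inj₁ refl)
    arith _ _ _ (inj₁ refl) (inj₂ (() , refl)) (inj₂ (_ , refl))
    arith _ _ _ (inj₂ (() , refl)) (inj₁ refl) (inj₁ refl)
    arith _ _ _ (inj₂ (_ , refl)) (inj₁ refl) (inj₂ (() , _))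
    arith _ _ _ (inj₂ (() , refl)) (inj₂ (_ , refl)) (inj₁ refl)
    arith _ _ _ (inj₂ (_ , refl)) (inj₂ (() , refl)) (inj₂ _)

  Next-functional : ∀ {k} {i j l : Fin (4 + k)} → Next l i → Next l j → i ≡ j
  Next-functional l→i l→j =
    toℕ-injective (trans (sym (Next⇒CycNext l→i)) (Next⇒CycNext l→j))

  -- The two cycle neighbours of a vertex are distinct and nonadjacent, since the length is at least
  -- four.
  hole⇒rigid : ∀ {T} → HoleIn T → Σ (Subset n) λ W → W ⊆ T × Rigid W
  hole⇒rigid {T} (k , (c , c-inj , c-adj) , c∈T) = W , W⊆T , (c zero , c∈W zero) , nonSimplicial
    where
    image? : Decidable (λ x → ∃[ i ] x ≡ c i)
    image? x = any? (λ i → x ≟ c i)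

    W = ⟪ image? ⟫

    c∈W : ∀ i → c i ∈ W
    c∈W i = ∈⟪⟫⁺ image? (i , refl)

    W⊆T : W ⊆ T
    W⊆T x∈W with ∈⟪⟫⁻ image? x∈W
    ... | i , refl = c∈T i

    nonSimplicial : ∀ {x} → x ∈ W → ∃[ s ] ∃[ t ] s ∈ W × t ∈ W × x ~ s × x ~ t × ¬ s ≃ t
    nonSimplicial x∈W with ∈⟪⟫⁻ image? x∈W
    ... | i , refl with successor i | predecessor i
    ...   | j , i→j | l , l→i =
      c j , c l , c∈W j , c∈W l ,
      proj₂ (c-adj i j) (inj₁ (Next⇒CycNext i→j)) ,
      proj₂ (c-adj i l) (inj₂ (Next⇒CycNext l→i)) , λ where
        (inj₁ eq)  → no-2-cycle i→j (subst (λ z → Next z i) (sym (c-inj eq)) l→i)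
        (inj₂ adj) → [ (λ j→l → no-3-cycle i→j (CycNext⇒Next j→l) l→i)
                     , (λ l→j → no-loop (subst (Next i)
                          (sym (Next-functional l→i (CycNext⇒Next l→j))) i→j))
                     ]′ (proj₁ (c-adj j l) adj)
      where
      no-loop : ¬ Next i i
      no-loop i→i = no-2-cycle i→i i→i

  -- Excluding `_≃_` rather than only `_~_` makes the path injective as well.
  IsInducedPath : ∀ m → (Fin (suc m) → V) → Set
  IsInducedPath zero    f = ⊤
  IsInducedPath (suc m) f =
    f zero ~ f (suc zero) × (∀ i → ¬ f zero ≃ f (suc (suc i))) × IsInducedPath m (f ∘ suc)

  path-adj : ∀ m {f} → IsInducedPath m f → ∀ {i j} → suc (toℕ i) ≡ toℕ j → f i ~ f j
  path-adj (suc m) (adj , _ , path) {zero}  {suc zero} eq = adj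
  path-adj (suc m) (_ , _ , path)   {suc i} {suc j}    eq = path-adj m path (ℕₚ.suc-injective eq)

  path-far : ∀ m {f} → IsInducedPath m f → ∀ {i j} → suc (toℕ i) ℕ.< toℕ j → ¬ f i ≃ f j
  path-far (suc m) (_ , far , path) {zero}  {suc (suc j)} _       = far j
  path-far (suc m) (_ , far , path) {zero}  {suc zero}    (s≤s ())
  path-far (suc m) (_ , far , path) {suc i} {suc j}       (s≤s p) = path-far m path p

  path-≢ : ∀ m {f} → IsInducedPath m f → ∀ {i j} → toℕ i ℕ.< toℕ j → f i ≢ f j
  path-≢ m path i<j with ℕₚ.m≤n⇒m<n∨m≡n i<j
  ... | inj₁ 1+i<j = path-far m path 1+i<j ∘ inj₁
  ... | inj₂ 1+i≡j = ~⇒≢ (path-adj m path 1+i≡j)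

  path-injective : ∀ m {f} → IsInducedPath m f → ∀ {i j} → f i ≡ f j → i ≡ j
  path-injective m path {i} {j} eq with <-cmp i j
  ... | tri< i<j _ _ = contradiction eq (path-≢ m path i<j)
  ... | tri≈ _ i≡j _ = i≡j
  ... | tri> _ _ j<i = contradiction (sym eq) (path-≢ m path j<i)

  path-adj⁻ : ∀ m {f} → IsInducedPath m f → ∀ {i j} → f i ~ f j →
              suc (toℕ i) ≡ toℕ j ⊎ suc (toℕ j) ≡ toℕ i
  path-adj⁻ m path {i} {j} adj with <-cmp i j
  ... | tri≈ _ refl _ = contradiction adj (irrfl _)
  ... | tri< i<j _ _ with ℕₚ.m≤n⇒m<n∨m≡n i<j
  ...   | inj₁ 1+i<j = contradiction (inj₂ adj) (path-far m path 1+i<j)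
  ...   | inj₂ 1+i≡j = inj₁ 1+i≡j
  path-adj⁻ m path {i} {j} adj | tri> _ _ j<i with ℕₚ.m≤n⇒m<n∨m≡n j<i
  ...   | inj₁ 1+j<i = contradiction (inj₂ (~-sym adj)) (path-far m path 1+j<i)
  ...   | inj₂ 1+j≡i = inj₂ 1+j≡i

  InducedPath : (V → Set) → V → V → Set
  InducedPath B x y = ∃[ m ] Σ (Fin (suc m) → V) λ f →
    IsInducedPath m f × f zero ≡ x × f (fromℕ m) ≡ y × (∀ i → B (f i))

  module _ {B : V → Set} where

    extendHead : ∀ {x} m f → IsInducedPath m f → B x → (∀ i → B (f i)) →
                 (∀ i → ¬ x ≃ f (suc i)) → ¬ x ≃ f zero ⊎ InducedPath B x (f (fromℕ m))
    extendHead {x} m f path Bx Bf far with x ≃? f zero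
    ... | no x≄          = inj₁ x≄
    ... | yes (inj₁ x≡f₀) = inj₂ (m , f , path , sym x≡f₀ , refl , Bf)
    ... | yes (inj₂ x~f₀) = inj₂ (suc m , x ∷ f , (x~f₀ , far , path) , refl , refl ,
                                  λ { zero → Bx ; (suc i) → Bf i })

    -- Joining x to the last neighbour of x on an induced path keeps the path induced.
    extend : ∀ {x} m f → IsInducedPath m f → B x → (∀ i → B (f i)) →
             (∀ i → ¬ x ≃ f i) ⊎ InducedPath B x (f (fromℕ m))
    extend zero f path Bx Bf with extendHead zero f path Bx Bf (λ ())
    ... | inj₁ x≄ = inj₁ λ { zero → x≄ }
    ... | inj₂ p  = inj₂ p
    extend (suc m) f path@(_ , _ , path′) Bx Bf with extend m (f ∘ suc) path′ Bx (Bf ∘ suc)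
    ... | inj₂ p   = inj₂ p
    ... | inj₁ far with extendHead (suc m) f path Bx Bf far
    ...   | inj₁ x≄ = inj₁ λ { zero → x≄ ; (suc i) → far i }
    ...   | inj₂ p  = inj₂ p

    -- The walk is processed from its far end, `extend` taking the shortcuts. `B x` is a separate
    -- hypothesis since each step records `B` only at its target.
    walk⇒inducedPath : ∀ {x y} → B x → Star (λ a b → a ~ b × B b) x y → InducedPath B x y
    walk⇒inducedPath {x} Bx ε = 0 , (λ _ → x) , tt , refl , refl , λ _ → Bx
    walk⇒inducedPath Bx ((x~z , Bz) ◅ walk) with walk⇒inducedPath Bz walk
    ... | m , f , path , refl , refl , Bf with extend m f path Bx Bf
    ...   | inj₁ far = contradiction (inj₂ x~z) (far zero)
    ...   | inj₂ p   = p

  -- An induced path drawn from the walk has its interior outside N[v], so `v` closes it to an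
  -- induced cycle. The path has at least two edges, as `x` and `y` are neither equal nor adjacent;
  -- so the cycle has at least four vertices.
  walk⇒hole : ∀ {T v x y} → v ∈ T → x ∈ T → y ∈ T → v ~ x → v ~ y → ¬ x ≃ y →
              Star (λ a b → a ~ b × ((b ∈ T × ¬ v ≃ b) ⊎ b ≡ x ⊎ b ≡ y)) x y → HoleIn T
  walk⇒hole {T} {v} {x} {y} v∈T x∈T y∈T v~x v~y x≄y walk
    with walk⇒inducedPath (inj₂ (inj₁ refl)) walk
  ... | 0 , f , path , refl , refl , Bf = contradiction (inj₁ refl) x≄y
  ... | 1 , f , (adj , _) , refl , refl , Bf = contradiction (inj₂ adj) x≄y
  ... | suc (suc k) , f , path , refl , refl , Bf = k , (c , c-inj , λ i j → to i j , from i j) , c∈T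
    where
    c : Fin (4 + k) → V
    c = v ∷ f

    c∈T : ∀ i → c i ∈ T
    c∈T zero = v∈T
    c∈T (suc i) with Bf i
    ... | inj₁ (∈T , _)   = ∈T
    ... | inj₂ (inj₁ eq) = subst (_∈ T) (sym eq) x∈T
    ... | inj₂ (inj₂ eq) = subst (_∈ T) (sym eq) y∈T

    v≢f : ∀ i → v ≢ f i
    v≢f i eq with Bf i
    ... | inj₁ (_ , v≄)   = v≄ (inj₁ eq)
    ... | inj₂ (inj₁ eq′) = ~⇒≢ v~x (trans eq eq′)
    ... | inj₂ (inj₂ eq′) = ~⇒≢ v~y (trans eq eq′)

    v~f⁻ : ∀ i → v ~ f i → i ≡ zero ⊎ i ≡ fromℕ (2 + k)
    v~f⁻ i adj with Bf i
    ... | inj₁ (_ , v≄)   = contradiction (inj₂ adj) v≄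
    ... | inj₂ (inj₁ eq) = inj₁ (path-injective (2 + k) {f} path eq)
    ... | inj₂ (inj₂ eq) = inj₂ (path-injective (2 + k) {f} path eq)

    c-inj : ∀ {i j} → c i ≡ c j → i ≡ j
    c-inj {zero}  {zero}  eq = refl
    c-inj {zero}  {suc j} eq = contradiction eq (v≢f j)
    c-inj {suc i} {zero}  eq = contradiction (sym eq) (v≢f i)
    c-inj {suc i} {suc j} eq = cong suc (path-injective (2 + k) {f} path eq)

    v~f-next : ∀ i → v ~ f i → CycNext G {k} zero (suc i) ⊎ CycNext G {k} (suc i) zero
    v~f-next i adj with v~f⁻ i adj
    ... | inj₁ refl = inj₁ (Next⇒CycNext {k} {zero} {suc zero} (inj₁ refl))
    ... | inj₂ refl = inj₂ (Next⇒CycNext {i = suc (fromℕ (2 + k))} {zero}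
                        (inj₂ (cong (2 +_) (toℕ-fromℕ (2 + k)) , refl)))

    to : ∀ i j → c i ~ c j → CycNext G i j ⊎ CycNext G j i
    to zero    zero    adj = contradiction adj (irrfl v)
    to zero    (suc j) adj = v~f-next j adj
    to (suc i) zero    adj = swap (v~f-next i (~-sym adj))
    to (suc i) (suc j) adj with path-adj⁻ (2 + k) {f} path adj
    ... | inj₁ eq = inj₁ (Next⇒CycNext {i = suc i} {suc j} (inj₁ (cong suc eq)))
    ... | inj₂ eq = inj₂ (Next⇒CycNext {i = suc j} {suc i} (inj₁ (cong suc eq)))

    next-adj : ∀ i j → Next i j → c i ~ c j
    next-adj zero    (suc zero) (inj₁ refl)     = v~x
    next-adj (suc i) (suc j)    (inj₁ eq)       = path-adj (2 + k) {f} path (ℕₚ.suc-injective eq)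
    next-adj (suc i) zero       (inj₂ (eq , _)) = ~-sym (subst (λ z → v ~ f z) (toℕ-injective
      (trans (toℕ-fromℕ (2 + k)) (sym (ℕₚ.suc-injective (ℕₚ.suc-injective eq))))) v~y)

    from : ∀ i j → CycNext G i j ⊎ CycNext G j i → c i ~ c j
    from i j (inj₁ i→j) = next-adj i j (CycNext⇒Next i→j)
    from i j (inj₂ j→i) = ~-sym (next-adj j i (CycNext⇒Next j→i))

  -- Simplicial vertices of hole-free sets

  -- Dirac's theorem in a form strong enough for induction: the simplicial vertex can be chosen off
  -- any clique that does not fill `T`. An empty `K` gives plain existence.
  SimplicialOutsideClique : Subset n → Set₁
  SimplicialOutsideClique T = ∀ {K : V → Set} {d} → Decidable K →
    (∀ {x y} → x ∈ T → y ∈ T → K x → K y → x ≃ y) →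
    d ∈ T → ¬ K d → ∃[ z ] z ∈ T × ¬ K z × Simplicial T z

  -- If D is a component of T minus N[v], the attachments of D in N(v) form a clique: two
  -- nonadjacent ones would close a hole through v and D. So the induction hypothesis gives
  -- a simplicial vertex of D together with its attachments, lying in D.
  simplicial-far : ∀ {T v d} → (∀ {U} → U ⊂ T → SimplicialOutsideClique U) → ¬ HoleIn T →
                   v ∈ T → d ∈ T → ¬ v ≃ d → ∃[ z ] z ∈ T × ¬ v ≃ z × Simplicial T z
  simplicial-far {T} {v} {d} smaller noHole v∈T d∈T v≄d =
    let z , z∈U , v≄z , simplicial =
          smaller U⊂T (v ≃?_) attachments-clique (∈⟪⟫⁺ inU? (d∈T , d , d∈D , inj₁ refl)) v≄d
    -- `z` lies in `D`, so `U` contains all its neighbours in `T`, and simplicial in `U` implies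
    -- simplicial in `T`.
    in z , U⊆T z∈U , v≄z , λ s∈T t∈T z~s z~t →
         simplicial (nbr∈U z∈U v≄z s∈T z~s) (nbr∈U z∈U v≄z t∈T z~t) z~s z~t
    where
    Far : V → Set
    Far x = x ∈ T × ¬ v ≃ x

    R : V → V → Set
    R x y = x ~ y × Far x × Far y

    R-sym : ∀ {x y} → R x y → R y x
    R-sym (x~y , x-far , y-far) = ~-sym x~y , y-far , x-far

    far? : Decidable Far
    far? x = (x ∈? T) ×-dec ¬? (v ≃? x)

    component : ReachableSet R d
    component = reachableSet (λ x y → (x ~? y) ×-dec far? x ×-dec far? y) d

    D = proj₁ component
    d∈D = proj₁ (proj₂ component)
    D-walk = proj₁ (proj₂ (proj₂ component))
    D-closed = proj₂ (proj₂ (proj₂ component))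

    D-far : ∀ {x} → x ∈ D → Far x
    -- The reversed walk begins at `x`, so its first step records that `x` is far from `v`.
    D-far x∈D with reverse {T = R} R-sym (D-walk x∈D)
    ... | ε = d∈T , v≄d
    ... | (_ , x-far , _) ◅ _ = x-far

    inU? : Decidable (λ x → x ∈ T × ∃[ a ] a ∈ D × a ≃ x)
    inU? x = (x ∈? T) ×-dec any? (λ a → (a ∈? D) ×-dec (a ≃? x))

    U = ⟪ inU? ⟫

    U⊆T : U ⊆ T
    U⊆T x∈U = proj₁ (∈⟪⟫⁻ inU? x∈U)

    U⊂T : U ⊂ T
    U⊂T = U⊆T , v , v∈T , λ v∈U → let _ , a , a∈D , a≃v = ∈⟪⟫⁻ inU? v∈U in
      proj₂ (D-far a∈D) (≃-sym a≃v)

    U-far⇒D : ∀ {x} → x ∈ U → ¬ v ≃ x → x ∈ D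
    U-far⇒D x∈U v≄x with ∈⟪⟫⁻ inU? x∈U
    ... | _ , a , a∈D , inj₁ refl = a∈D
    ... | x∈T , a , a∈D , inj₂ a~x = D-closed a∈D (a~x , D-far a∈D , x∈T , v≄x)

    nbr∈U : ∀ {z s} → z ∈ U → ¬ v ≃ z → s ∈ T → z ~ s → s ∈ U
    nbr∈U z∈U v≄z s∈T z~s = ∈⟪⟫⁺ inU? (s∈T , _ , U-far⇒D z∈U v≄z , inj₂ z~s)

    -- D lies outside N[v], so x is not in D, and v itself is not adjacent to D.
    attached : ∀ {x} → x ∈ U → v ≃ x → v ~ x × ∃[ a ] a ∈ D × a ~ x
    attached x∈U v≃x with ∈⟪⟫⁻ inU? x∈U
    ... | _ , a , a∈D , inj₁ refl = contradiction v≃x (proj₂ (D-far a∈D))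
    ... | _ , a , a∈D , inj₂ a~x with v≃x
    ...   | inj₁ refl = contradiction (inj₂ (~-sym a~x)) (proj₂ (D-far a∈D))
    ...   | inj₂ v~x  = v~x , a , a∈D , a~x

    attachments-clique : ∀ {x y} → x ∈ U → y ∈ U → v ≃ x → v ≃ y → x ≃ y
    attachments-clique {x} {y} x∈U y∈U v≃x v≃y with x ≃? y
    ... | yes x≃y = x≃y
    ... | no  x≄y with attached x∈U v≃x | attached y∈U v≃y
    ...   | v~x , a , a∈D , a~x | v~y , b , b∈D , b~y =
      -- The walk goes from `x` to `a`, through `D` to `d` and on to `b`, and ends at `y`.
      contradiction (walk⇒hole v∈T (U⊆T x∈U) (U⊆T y∈U) v~x v~y x≄y
        ((~-sym a~x , inj₁ (D-far a∈D)) ◅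
          gmap id (λ (p~q , _ , q-far) → p~q , inj₁ q-far)
            (reverse {T = R} R-sym (D-walk a∈D) ◅◅ D-walk b∈D) ◅◅
          (b~y , inj₂ (inj₂ refl)) ◅ ε)) noHole

  simplicial-universal : ∀ {T p z} → (∀ {x} → x ∈ T → p ≃ x) →
                         Simplicial (T ∖ p) z → Simplicial T z
  simplicial-universal {T} {p} universal simplicial {s} {t} s∈T t∈T z~s z~t with s ≟ p | t ≟ p
  ... | yes refl | _        = universal t∈T
  ... | no  _    | yes refl = ≃-sym (universal s∈T)
  ... | no  s≢p  | no  t≢p  = simplicial (∈∖⁺ s∈T s≢p) (∈∖⁺ t∈T t≢p) z~s z~t

  -- If `K` meets `T` in `k`, a simplicial vertex outside N[k] avoids `K`; if N[k] contains `T`,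
  -- deleting `k` leads to a smaller set. If `K` misses `T`, then `d` plays the part of `k`, and is
  -- itself the answer when nothing else is left.
  simplicial-outside-clique-step : ∀ {T} → (∀ {U} → U ⊂ T → SimplicialOutsideClique U) →
                                   ¬ HoleIn T → SimplicialOutsideClique T
  simplicial-outside-clique-step {T} smaller noHole {K} {d} K? clique d∈T ¬Kd
    with any? (λ k → (k ∈? T) ×-dec K? k)
  ... | yes (k , k∈T , Kk) with any? (λ e → (e ∈? T) ×-dec ¬? (k ≃? e))
  ...   | yes (e , e∈T , k≄e) =
    let z , z∈T , k≄z , simplicial = simplicial-far smaller noHole k∈T e∈T k≄e
    in z , z∈T , (λ Kz → k≄z (clique k∈T z∈T Kk Kz)) , simplicial
  ...   | no universal =
    let z , z∈ , ¬Kz , simplicial =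
          smaller (∖-⊂ k∈T) K?
            (λ x∈ y∈ → clique (proj₁ (∈∖⁻ x∈)) (proj₁ (∈∖⁻ y∈)))
            (∈∖⁺ d∈T λ { refl → ¬Kd Kk }) ¬Kd
    in z , proj₁ (∈∖⁻ z∈) , ¬Kz , simplicial-universal
         (λ {x} x∈T → decidable-stable (k ≃? x) λ k≄x → universal (x , x∈T , k≄x)) simplicial
  simplicial-outside-clique-step {T} smaller noHole {K} {d} K? clique d∈T ¬Kd
      | no K∩T-empty with any? (λ e → (e ∈? T) ×-dec ¬? (d ≃? e))
  ...   | yes (e , e∈T , d≄e) =
    let z , z∈T , _ , simplicial = simplicial-far smaller noHole d∈T e∈T d≄e
    in z , z∈T , (λ Kz → K∩T-empty (z , z∈T , Kz)) , simplicial
  ...   | no universal with any? (_∈? (T ∖ d))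
  ...     | yes (e , e∈) =
    let z , z∈ , ¬Kz , simplicial =
          smaller (∖-⊂ d∈T) K?
            (λ x∈ y∈ → clique (proj₁ (∈∖⁻ x∈)) (proj₁ (∈∖⁻ y∈)))
            e∈ (λ Ke → K∩T-empty (e , proj₁ (∈∖⁻ e∈) , Ke))
    in z , proj₁ (∈∖⁻ z∈) , ¬Kz , simplicial-universal
         (λ {x} x∈T → decidable-stable (d ≃? x) λ d≄x → universal (x , x∈T , d≄x)) simplicial
  ...     | no only-d = d , d∈T , ¬Kd , λ {s} {t} s∈T t∈T d~s d~t →
    ⊥-elim (only-d (s , ∈∖⁺ s∈T (~⇒≢ (~-sym d~s))))

  simplicial-outside-clique : ∀ {T} → ¬ HoleIn T → SimplicialOutsideClique T
  simplicial-outside-clique = go (⊂-wellFounded _)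
    where
    go : ∀ {T} → Acc _⊂_ T → ¬ HoleIn T → SimplicialOutsideClique T
    go (acc smaller) noHole = simplicial-outside-clique-step
      (λ U⊂T → go (smaller U⊂T) (noHole ∘ HoleIn-mono (proj₁ U⊂T))) noHole

  simplicial-nonneighbour : ∀ {T v d} → ¬ HoleIn T → v ∈ T → d ∈ T → ¬ v ≃ d →
                            ∃[ z ] z ∈ T × ¬ v ≃ z × Simplicial T z
  simplicial-nonneighbour noHole = simplicial-far
    (λ U⊂T → simplicial-outside-clique (noHole ∘ HoleIn-mono (proj₁ U⊂T))) noHole

  -- Dismantling

  -- A retraction of reflexive graphs: `moves` concerns `_≃_`, so an edge may collapse to a vertex.
  record Retraction (S : Subset n) (f : V → V) : Set where
    field
      into   : ∀ x → f x ∈ S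
      fixed  : ∀ {x} → x ∈ S → f x ≡ x
      moves  : ∀ {x y} → x ≃ y → f x ≃ f y
  open Retraction

  id-retraction : Retraction full id
  id-retraction = record { into = λ _ → ∈⊤ ; fixed = λ _ → refl ; moves = id }

  Dominated : Subset n → V → V → Set
  Dominated S u v = ∀ {w} → w ∈ S → u ≃ w → v ≃ w

  fold : V → V → V → V
  fold u v x with x ≟ u
  ... | yes _ = v
  ... | no  _ = x

  fold-retraction : ∀ {S f u v} → Retraction S f → u ∈ S → v ∈ S → u ≢ v → Dominated S u v →
                    Retraction (S ∖ u) (fold u v ∘ f)
  fold-retraction {S} {f} {u} {v} ret u∈S v∈S u≢v dom = record
    { into  = λ x → fold-into (into ret x)
    ; fixed = λ x∈ → let x∈S , x≢u = ∈∖⁻ x∈ in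
                     trans (cong (fold u v) (fixed ret x∈S)) (fold-fixed x≢u)
    ; moves = λ x≃y → fold-moves (into ret _) (into ret _) (moves ret x≃y)
    }
    where
    fold-into : ∀ {x} → x ∈ S → fold u v x ∈ S ∖ u
    fold-into {x} x∈S with x ≟ u
    ... | yes _   = ∈∖⁺ v∈S (u≢v ∘ sym)
    ... | no  x≢u = ∈∖⁺ x∈S x≢u

    fold-fixed : ∀ {x} → x ≢ u → fold u v x ≡ x
    fold-fixed {x} x≢u with x ≟ u
    ... | yes x≡u = contradiction x≡u x≢u
    ... | no  _   = refl

    fold-moves : ∀ {x y} → x ∈ S → y ∈ S → x ≃ y → fold u v x ≃ fold u v y
    fold-moves {x} {y} x∈S y∈S x≃y with x ≟ u | y ≟ u
    ... | yes _    | yes _    = inj₁ refl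
    ... | yes refl | no  _    = dom y∈S x≃y
    ... | no  _    | yes refl = ≃-sym (dom x∈S (≃-sym x≃y))
    ... | no  _    | no  _    = x≃y

  -- With the robber to move, the cop at c can force landing on the shadow f r of the robber.
  data Catches (f : V → V) : V → V → Set where
    caught : ∀ {c r} → c ≡ f r → Catches f c r
    round  : ∀ {c r} → (∀ r′ → r ≃ r′ → ∃[ c′ ] c ≃ c′ × Catches f c′ r′) → Catches f c r

  ShadowCopWin : (V → V) → Set
  ShadowCopWin f = ∃[ c ] ∀ r → ∃[ c′ ] c ≃ c′ × Catches f c′ r

  -- A cop at v on the shadow of a robber at u answers every move of the robber by a capture.
  unfold : ∀ {S f u v c r} → Retraction S f → Dominated S u v →
           Catches (fold u v ∘ f) c r → Catches f c r
  unfold {f = f} {u} {v} {c} {r} ret dom (caught c≡) with f r ≟ u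
  ... | no  _    = caught c≡
  ... | yes refl = round λ r′ r≃r′ →
        f r′ , subst (_≃ f r′) (sym c≡) (dom (into ret r′) (moves ret r≃r′)) , caught refl
  unfold ret dom (round play) = round λ r′ r≃r′ →
    let c′ , c≃c′ , win = play r′ r≃r′ in c′ , c≃c′ , unfold ret dom win

  catches⇒copWins : ∀ {c r} → Catches id c r → CopWins G c r
  catches⇒copWins (caught c≡r) = caught c≡r
  catches⇒copWins {c} {r} (round play) with c ≟ r
  ... | yes c≡r = caught c≡r
  ... | no  c≢r = round c≢r λ r′ r≃r′ →
        let c′ , c≃c′ , win = play r′ r≃r′ in c′ , c≃c′ , catches⇒copWins win

  -- `f` maps the walk from `x` to `y` to one from `x` to `f y`, which differs from `x`; the first
  -- vertex of the image other than `x` is the neighbour sought.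
  neighbour-in-retract : ∀ {S f x y} → Retraction S f → x ≢ f y → f x ≡ x → Reach G x y →
                         ∃[ w ] w ∈ S × x ~ w
  neighbour-in-retract {f = f} ret x≢fy fx≡x here = contradiction (sym fx≡x) x≢fy
  neighbour-in-retract {S} {f} {x} ret x≢fy fx≡x (step x~z walk) = go walk (moves ret (inj₂ x~z))
    where
    go : ∀ {z} → Reach G z _ → f x ≃ f z → ∃[ w ] w ∈ S × x ~ w
    go {z} walk (inj₂ fx~fz) = f z , into ret z , subst (_~ f z) fx≡x fx~fz
    go here (inj₁ fx≡fz) = contradiction (trans (sym fx≡x) fx≡fz) x≢fy
    go (step z~z′ walk) (inj₁ fx≡fz) =
      go walk (subst (_≃ f _) (sym fx≡fz) (moves ret (inj₂ z~z′)))

  dismantle : ∀ {S f} → Connected G → Chordal G → Acc _⊂_ S → Retraction S f → ShadowCopWin f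
  dismantle {S} {f} conn@(x₀ , reach) chordal (acc smaller) ret
    with any? (_∈? (S ∖ f x₀))
  -- `S` is the single vertex `f x₀`, on which the robber's shadow always lies.
  ... | no singleton = f x₀ , λ r → f x₀ , inj₁ refl , caught (sym (decidable-stable (f r ≟ f x₀)
        λ fr≢ → singleton (f r , ∈∖⁺ (into ret r) fr≢)))
  ... | yes (y , y∈)
    with simplicial-outside-clique {S} (λ (k , c , _) → chordal k c) {K = λ _ → ⊥}
           (λ _ → no id) (λ _ _ ()) (into ret x₀) id
  ...   | u , u∈S , _ , simplicial =
    let other , other∈S , u≢other = another
        v , v∈S , u~v = neighbour-in-retract {y = other} ret
          (λ u≡ → u≢other (trans u≡ (fixed ret other∈S))) (fixed ret u∈S) (reach u other)
        -- N[u] within `S` is a clique, so each neighbour of `u` in `S` dominates it.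
        dom : Dominated S u v
        dom = λ { w∈S (inj₁ refl) → inj₂ (~-sym u~v) ; w∈S (inj₂ u~w) → simplicial v∈S w∈S u~v u~w }
        c , win = dismantle conn chordal (smaller (∖-⊂ u∈S))
                    (fold-retraction ret u∈S v∈S (~⇒≢ u~v) dom)
    in c , λ r → let c′ , c≃c′ , catches = win r in c′ , c≃c′ , unfold ret dom catches
    where
    another : ∃[ z ] z ∈ S × u ≢ z
    another with u ≟ y
    ... | no u≢y   = y , proj₁ (∈∖⁻ y∈) , u≢y
    ... | yes refl = f x₀ , into ret x₀ , proj₂ (∈∖⁻ y∈)

  chordal⇒copWin : Connected G → Chordal G → CopWin G
  chordal⇒copWin conn chordal =
    let c , win = dismantle conn chordal (⊂-wellFounded _) id-retraction
    in c , λ r → let c′ , c≃c′ , catches = win r in c′ , c≃c′ , catches⇒copWins catches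

  -- Stiff retracts and the robber's escape

  undominated? : ∀ S u v → Dec (∃[ w ] w ∈ S × u ≃ w × ¬ v ≃ w)
  undominated? S u v = any? (λ w → (w ∈? S) ×-dec (u ≃? w) ×-dec ¬? (v ≃? w))

  -- No fold is possible. The witness `w` is non-domination in positive form and supplies the
  -- robber's next move.
  Stiff : Subset n → Set
  Stiff S = ∀ {u v} → u ∈ S → v ∈ S → u ≢ v → ∃[ w ] w ∈ S × u ≃ w × ¬ v ≃ w

  -- The retraction turns every cop move into a move of the shadow `f c`. The robber steps to a
  -- vertex of `S` outside N[f c], which the next shadow cannot occupy. So the descent through
  -- `CopWins` never admits the leaf `caught`.
  stiff-evades : ∀ {S f c r} → Retraction S f → Stiff S → r ∈ S → f c ≢ r → ¬ CopWins G c r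
  stiff-evades ret stiff r∈S fc≢r (caught refl) = fc≢r (fixed ret r∈S)
  stiff-evades {f = f} {c} ret stiff r∈S fc≢r (round _ play) =
    let r′ , r′∈S , r≃r′ , fc≄r′ = stiff r∈S (into ret c) (fc≢r ∘ sym)
        c′ , c≃c′ , win = play r′ r≃r′
    in stiff-evades ret stiff r′∈S (λ fc′≡r′ → fc≄r′ (subst (f c ≃_) fc′≡r′ (moves ret c≃c′))) win

  -- The cop moves first, so the robber must start outside N[f c]. Stiffness provides such a vertex
  -- once `S` has one other than `f c`, hence the two vertices `x` and `y`.
  stiff⇒¬copWin : ∀ {S f x y} → Retraction S f → Stiff S → x ∈ S → y ∈ S → x ≢ y → ¬ CopWin G
  stiff⇒¬copWin {S} {f} {x} {y} ret stiff x∈S y∈S x≢y (c , win) =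
    let r₀ , r₀∈S , r₀≢fc = other
        r , r∈S , _ , fc≄r = stiff r₀∈S (into ret c) r₀≢fc
        c′ , c≃c′ , wins = win r
    in stiff-evades ret stiff r∈S (λ fc′≡r → fc≄r (subst (f c ≃_) fc′≡r (moves ret c≃c′))) wins
    where
    other : ∃[ r ] r ∈ S × r ≢ f c
    other with x ≟ f c
    ... | no  x≢fc = x , x∈S , x≢fc
    ... | yes x≡fc = y , y∈S , λ y≡fc → x≢y (trans x≡fc (sym y≡fc))

  Wheel : Set
  Wheel = ∃[ h ] Σ (Subset n) λ W → Rigid W × (∀ {x} → x ∈ W → h ~ x)

  -- W ∖ v works: if v had a non-neighbour in W, it would have one that is simplicial in
  -- (W ∖ u) ∪ {v}; not being a neighbour of u, that vertex would be simplicial in W.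
  dominated-rigid⇒wheel : ∀ {S W u v} → ¬ HoleIn (S ∖ u) → u ∈ S → v ∈ S → u ≢ v →
                          Dominated S u v → W ⊆ S → Rigid W → u ∈ W → Wheel
  dominated-rigid⇒wheel {S} {W} {u} {v} noHole u∈S v∈S u≢v dom W⊆S (_ , rigid) u∈W =
    v , W ∖ v , ((u , ∈∖⁺ u∈W u≢v) , rigid′) , λ x∈ → let x∈W , x≢v = ∈∖⁻ x∈ in
      ≃∧≢⇒~ (universal x∈W) (x≢v ∘ sym)
    where
    inT? : Decidable (λ x → (x ∈ W × x ≢ u) ⊎ x ≡ v)
    inT? x = ((x ∈? W) ×-dec ¬? (x ≟ u)) ⊎-dec (x ≟ v)

    T = ⟪ inT? ⟫

    T⊆S∖u : T ⊆ S ∖ u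
    T⊆S∖u x∈T with ∈⟪⟫⁻ inT? x∈T
    ... | inj₁ (x∈W , x≢u) = ∈∖⁺ (W⊆S x∈W) x≢u
    ... | inj₂ refl        = ∈∖⁺ v∈S (u≢v ∘ sym)

    noHoleT : ¬ HoleIn T
    noHoleT = noHole ∘ HoleIn-mono T⊆S∖u

    noSimplicial : ¬ (∃[ z ] z ∈ T × ¬ v ≃ z × Simplicial T z)
    noSimplicial (z , z∈T , v≄z , simplicial) with ∈⟪⟫⁻ inT? z∈T
    ... | inj₂ refl      = v≄z (inj₁ refl)
    ... | inj₁ (z∈W , _) =
      let s , t , s∈W , t∈W , z~s , z~t , s≄t = rigid z∈W
      in s≄t (simplicial (nbr∈T s∈W z~s) (nbr∈T t∈W z~t) z~s z~t)
      where
      nbr∈T : ∀ {s} → s ∈ W → z ~ s → s ∈ T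
      nbr∈T s∈W z~s = ∈⟪⟫⁺ inT? (inj₁ (s∈W , λ { refl → v≄z (dom (W⊆S z∈W) (inj₂ (~-sym z~s))) }))

    universal : ∀ {x} → x ∈ W → v ≃ x
    universal {x} x∈W with x ≟ u
    ... | yes refl = dom u∈S (inj₁ refl)
    ... | no  x≢u  = decidable-stable (v ≃? x) λ v≄x → noSimplicial
      (simplicial-nonneighbour noHoleT (∈⟪⟫⁺ inT? (inj₂ refl)) (∈⟪⟫⁺ inT? (inj₁ (x∈W , x≢u))) v≄x)

    rigid′ : ∀ {x} → x ∈ W ∖ v → ∃[ s ] ∃[ t ] s ∈ W ∖ v × t ∈ W ∖ v × x ~ s × x ~ t × ¬ s ≃ t
    rigid′ x∈ with rigid (proj₁ (∈∖⁻ x∈))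
    ... | s , t , s∈W , t∈W , x~s , x~t , s≄t =
      -- As `v` sees all of `W`, neither member of a nonadjacent pair is `v`.
      s , t , ∈∖⁺ s∈W (λ { refl → s≄t (universal t∈W) }) ,
      ∈∖⁺ t∈W (λ { refl → s≄t (≃-sym (universal s∈W)) }) , x~s , x~t , s≄t

  -- Induction on `S`. Folding some `u` outside `W` keeps `W`. For `u` in `W`, the induction
  -- hypothesis and `copWin` forbid rigid sets, hence holes, in `S` without `u`, and a wheel
  -- results.
  rigid-retract⇒¬copWin : ∀ {S f W} → ¬ Wheel → Acc _⊂_ S → Retraction S f →
                          W ⊆ S → Rigid W → ¬ CopWin G
  rigid-retract⇒¬copWin {S} {f} {W} noWheel (acc smaller) ret W⊆S rigidW copWin
    with any? (λ u → any? (λ v → (u ∈? S) ×-dec (v ∈? S) ×-dec ¬? (u ≟ v) ×-dec ¬? (undominated? S u v)))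
  ... | no ¬dom =
    let (x , x∈W) , rigid = rigidW
        s , t , s∈W , t∈W , _ , _ , s≄t = rigid x∈W
    in stiff⇒¬copWin ret
         (λ {u} {v} u∈S v∈S u≢v → decidable-stable (undominated? S u v)
           λ ¬w → ¬dom (u , v , u∈S , v∈S , u≢v , ¬w))
         (W⊆S s∈W) (W⊆S t∈W) (s≄t ∘ inj₁) copWin
  ... | yes (u , v , u∈S , v∈S , u≢v , ¬w) = contra (u ∈? W)
    where
    dom : Dominated S u v
    dom {w} w∈S u≃w = decidable-stable (v ≃? w) λ v≄w → ¬w (w , w∈S , u≃w , v≄w)

    noRigid : ∀ {W′} → W′ ⊆ S ∖ u → ¬ Rigid W′
    noRigid W′⊆ rigid′ = rigid-retract⇒¬copWin noWheel (smaller (∖-⊂ u∈S))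
      (fold-retraction ret u∈S v∈S u≢v dom) W′⊆ rigid′ copWin

    contra : Dec (u ∈ W) → ⊥
    contra (no u∉W)  = noRigid (λ {x} x∈W → ∈∖⁺ (W⊆S x∈W) λ { refl → u∉W x∈W }) rigidW
    contra (yes u∈W) = noWheel (dominated-rigid⇒wheel
      (λ hole → let _ , W′⊆ , rigid′ = hole⇒rigid hole in noRigid W′⊆ rigid′)
      u∈S v∈S u≢v dom W⊆S rigidW u∈W)

  copWin⇒chordal : ¬ Wheel → CopWin G → Chordal G
  copWin⇒chordal noWheel copWin k c =
    let _ , W⊆full , rigid = hole⇒rigid (k , c , λ _ → ∈⊤)
    in rigid-retract⇒¬copWin noWheel (⊂-wellFounded _) id-retraction W⊆full rigid copWin

  -- Wheels are not outer 1-planar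

  module _ (pos : V → V) (pos-inj : ∀ {x y} → pos x ≡ pos y → x ≡ y) where

    infix 4 _⊏_

    _⊏_ : V → V → Set
    x ⊏ y = pos x < pos y

    ⊏-asym : ∀ {x y} → x ⊏ y → ¬ y ⊏ x
    ⊏-asym = <-asym

    ⊏-trans : ∀ {x y z} → x ⊏ y → y ⊏ z → x ⊏ z
    ⊏-trans = <-trans

    ⊏⇒≢ : ∀ {x y} → x ⊏ y → x ≢ y
    ⊏⇒≢ x⊏x refl = ⊏-asym x⊏x x⊏x

    ⊏-total : ∀ {x y} → x ≢ y → x ⊏ y ⊎ y ⊏ x
    ⊏-total {x} {y} x≢y with <-cmp (pos x) (pos y)
    ... | tri< x⊏y _ _ = inj₁ x⊏y
    ... | tri≈ _ eq _  = contradiction (pos-inj eq) x≢y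
    ... | tri> _ _ y⊏x = inj₂ y⊏x

    -- Going round the circle from `a`, one meets `b` before `c`. For fixed `a` this is the linear
    -- order got by cutting the circle at `a`.
    Cyclic : V → V → V → Set
    Cyclic a b c = (a ⊏ b × b ⊏ c) ⊎ (b ⊏ c × c ⊏ a) ⊎ (c ⊏ a × a ⊏ b)

    rotate : ∀ {a b c} → Cyclic a b c → Cyclic b c a
    rotate (inj₁ abc)        = inj₂ (inj₂ abc)
    rotate (inj₂ (inj₁ bca)) = inj₁ bca
    rotate (inj₂ (inj₂ cab)) = inj₂ (inj₁ cab)

    cyclic-trans : ∀ {a b c d} → Cyclic a b c → Cyclic a c d → Cyclic a b d
    cyclic-trans (inj₁ (ab , bc))        (inj₁ (ac , cd))        = inj₁ (ab , ⊏-trans bc cd)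
    cyclic-trans (inj₁ (ab , bc))        (inj₂ (inj₁ (cd , da))) =
      contradiction (⊏-trans cd da) (⊏-asym (⊏-trans ab bc))
    cyclic-trans (inj₁ (ab , bc))        (inj₂ (inj₂ (da , ac))) = inj₂ (inj₂ (da , ab))
    cyclic-trans (inj₂ (inj₁ (bc , ca))) (inj₁ (ac , cd))        = contradiction ca (⊏-asym ac)
    cyclic-trans (inj₂ (inj₁ (bc , ca))) (inj₂ (inj₁ (cd , da))) = inj₂ (inj₁ (⊏-trans bc cd , da))
    cyclic-trans (inj₂ (inj₁ (bc , ca))) (inj₂ (inj₂ (da , ac))) = contradiction ca (⊏-asym ac)
    cyclic-trans (inj₂ (inj₂ (ca , ab))) (inj₁ (ac , cd))        = contradiction ca (⊏-asym ac)
    cyclic-trans (inj₂ (inj₂ (ca , ab))) (inj₂ (inj₁ (cd , da))) = inj₂ (inj₂ (da , ab))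
    cyclic-trans (inj₂ (inj₂ (ca , ab))) (inj₂ (inj₂ (da , ac))) = contradiction ca (⊏-asym ac)

    -- Transitivity seen from `b`: `c` precedes `h`, and `h` precedes `a`.
    cyclic-drop : ∀ {h a b c} → Cyclic h a b → Cyclic h b c → Cyclic a b c
    cyclic-drop hab hbc = rotate (rotate (cyclic-trans (rotate hbc) (rotate (rotate hab))))

    cyclic-total : ∀ {a b c} → a ≢ b → b ≢ c → c ≢ a → Cyclic a b c ⊎ Cyclic a c b
    cyclic-total a≢b b≢c c≢a with ⊏-total a≢b | ⊏-total b≢c | ⊏-total c≢a
    ... | inj₁ ab | inj₁ bc | _       = inj₁ (inj₁ (ab , bc))
    ... | inj₁ ab | inj₂ cb | inj₁ ca = inj₁ (inj₂ (inj₂ (ca , ab)))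
    ... | inj₁ ab | inj₂ cb | inj₂ ac = inj₂ (inj₁ (ac , cb))
    ... | inj₂ ba | inj₁ bc | inj₁ ca = inj₁ (inj₂ (inj₁ (bc , ca)))
    ... | inj₂ ba | inj₁ bc | inj₂ ac = inj₂ (inj₂ (inj₂ (ba , ac)))
    ... | inj₂ ba | inj₂ cb | _       = inj₂ (inj₂ (inj₁ (cb , ba)))

    cyclic⇒≢ : ∀ {a b c} → Cyclic a b c → b ≢ c
    cyclic⇒≢ (inj₁ (_ , bc))        = ⊏⇒≢ bc
    cyclic⇒≢ (inj₂ (inj₁ (bc , _))) = ⊏⇒≢ bc
    cyclic⇒≢ (inj₂ (inj₂ (ca , ab))) = ⊏⇒≢ (⊏-trans ca ab) ∘ sym

    cyclic-spo : ∀ h → IsStrictPartialOrder _≡_ (Cyclic h)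
    cyclic-spo h = record
      { isEquivalence = isEquivalence
      ; irrefl        = λ eq hxy → cyclic⇒≢ hxy eq
      ; trans         = cyclic-trans
      ; <-resp-≈      = (λ { refl → id }) , (λ { refl → id })
      }

    below : ∀ {a b c} → c ⊏ a → c ⊏ b → Outside G pos a b c
    below ca cb =
      [ (λ (ac , _) → ⊏-asym ca ac) , (λ (bc , _) → ⊏-asym cb bc) ]′ , ⊏⇒≢ ca , ⊏⇒≢ cb

    above : ∀ {a b c} → a ⊏ c → b ⊏ c → Outside G pos a b c
    above ac bc = [ (λ (_ , cb) → ⊏-asym bc cb) , (λ (_ , ca) → ⊏-asym ac ca) ]′ ,
      ⊏⇒≢ ac ∘ sym , ⊏⇒≢ bc ∘ sym

    -- Each of the two arcs between `u` and `v` contains one of `w`, `x`. Which one lies between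
    -- them in the linear order depends on whether `u` or `v` comes first.
    cyclic⇒cross : ∀ {u v w x} → Cyclic u w v → Cyclic v x u → Cross G pos u v w x
    cyclic⇒cross (inj₁ (uw , wv)) (inj₁ (vx , xu)) =
      contradiction (⊏-trans vx xu) (⊏-asym (⊏-trans uw wv))
    cyclic⇒cross (inj₁ uwv) (inj₂ (inj₁ (xu , uv))) = inj₁ (inj₁ uwv , below xu (⊏-trans xu uv))
    cyclic⇒cross (inj₁ uwv) (inj₂ (inj₂ (uv , vx))) = inj₁ (inj₁ uwv , above (⊏-trans uv vx) vx)
    cyclic⇒cross (inj₂ (inj₁ (wv , vu))) (inj₁ vxu) = inj₂ (below (⊏-trans wv vu) wv , inj₂ vxu)
    cyclic⇒cross (inj₂ (inj₂ (vu , uw))) (inj₁ vxu) = inj₂ (above uw (⊏-trans vu uw) , inj₂ vxu)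
    cyclic⇒cross (inj₂ (inj₁ (_ , vu)))  (inj₂ (inj₁ (_ , uv))) = contradiction uv (⊏-asym vu)
    cyclic⇒cross (inj₂ (inj₁ (_ , vu)))  (inj₂ (inj₂ (uv , _))) = contradiction uv (⊏-asym vu)
    cyclic⇒cross (inj₂ (inj₂ (vu , _)))  (inj₂ (inj₁ (_ , uv))) = contradiction uv (⊏-asym vu)
    cyclic⇒cross (inj₂ (inj₂ (vu , _)))  (inj₂ (inj₂ (uv , _))) = contradiction uv (⊏-asym vu)

    cyclic? : ∀ a b c → Dec (Cyclic a b c)
    cyclic? a b c =
      (pos a <? pos b ×-dec pos b <? pos c) ⊎-dec
      (pos b <? pos c ×-dec pos c <? pos a) ⊎-dec
      (pos c <? pos a ×-dec pos a <? pos b)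

    first : ∀ h {W x} → x ∈ W → ∃[ p ] p ∈ W × (∀ {y} → y ∈ W → ¬ Cyclic h y p)
    first h {W} = descend (spo-wellFounded (cyclic-spo h) _)
      where
      descend : ∀ {x} → Acc (Cyclic h) x → x ∈ W → ∃[ p ] p ∈ W × (∀ {y} → y ∈ W → ¬ Cyclic h y p)
      descend {x} (acc earlier) x∈W with any? (λ y → (y ∈? W) ×-dec cyclic? h y x)
      ... | yes (y , y∈W , hyx) = descend (earlier hyx) y∈W
      ... | no  isFirst         = x , x∈W , λ y∈W hyx → isFirst (_ , y∈W , hyx)

    -- The edge pt crosses the spoke hs. It crosses qs if q comes after t, and hq otherwise.
    two-crossings : AtMostOneCrossing G pos → ∀ {h p s t q} →
                    p ~ t → h ~ s → h ~ t → h ~ q → s ~ q → q ≢ t →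
                    Cyclic h p s → Cyclic h s t → ¬ Cyclic h p q
    two-crossings once {h} {p} {s} {t} {q} p~t h~s h~t h~q s~q q≢t hps hst hpq
      with cyclic-total (~⇒≢ h~t) (q≢t ∘ sym) (~⇒≢ h~q ∘ sym)
    ... | inj₁ htq =
      [ ~⇒≢ h~q ∘ proj₂ , ~⇒≢ s~q ∘ proj₁ ]′
        (once p t s h s q p~t (~-sym h~s) s~q crosses-sh
          (cyclic⇒cross pst (rotate (cyclic-drop hpt htq))))
      where
      hpt = cyclic-trans hps hst
      pst = cyclic-drop hps hst
      crosses-sh = cyclic⇒cross pst (rotate (rotate hpt))
    ... | inj₂ hqt =
      [ ~⇒≢ s~q ∘ proj₁ , ~⇒≢ h~s ∘ sym ∘ proj₁ ]′
        (once p t s h q h p~t (~-sym h~s) (~-sym h~q)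
          (cyclic⇒cross (cyclic-drop hps hst) thp)
          (cyclic⇒cross (cyclic-drop hpq hqt) thp))
      where
      thp = rotate (rotate (cyclic-trans hps hst))

    outer1Planar⇒¬wheel : AtMostOneCrossing G pos → ¬ Wheel
    outer1Planar⇒¬wheel once (h , W , ((_ , x∈W) , rigid) , h~W) with first h x∈W
    ... | p , p∈W , isFirst with rigid p∈W
    ...   | s , t , s∈W , t∈W , p~s , p~t , s≄t =
      [ clash s∈W t∈W p~s p~t s≄t , clash t∈W s∈W p~t p~s (s≄t ∘ ≃-sym) ]′
        (cyclic-total (~⇒≢ (h~W s∈W)) (s≄t ∘ inj₁) (~⇒≢ (h~W t∈W) ∘ sym))
      where
      p-before : ∀ {y} → y ∈ W → y ≢ p → Cyclic h p y
      p-before y∈W y≢p with cyclic-total (~⇒≢ (h~W p∈W)) (y≢p ∘ sym) (~⇒≢ (h~W y∈W) ∘ sym)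
      ... | inj₁ hpy = hpy
      ... | inj₂ hyp = contradiction hyp (isFirst y∈W)

      -- Two nonadjacent neighbours of `s` are distinct, so one of them is not `p`.
      other-neighbour : ∀ {s} → s ∈ W → ∃[ q ] q ∈ W × s ~ q × q ≢ p
      other-neighbour s∈W with rigid s∈W
      ... | a , b , a∈W , b∈W , s~a , s~b , a≄b with a ≟ p
      ...   | no  a≢p  = a , a∈W , s~a , a≢p
      ...   | yes refl = b , b∈W , s~b , λ b≡a → a≄b (inj₁ (sym b≡a))

      clash : ∀ {s t} → s ∈ W → t ∈ W → p ~ s → p ~ t → ¬ s ≃ t → ¬ Cyclic h s t
      clash s∈W t∈W p~s p~t s≄t hst =
        let q , q∈W , s~q , q≢p = other-neighbour s∈W
        in two-crossings once p~t (h~W s∈W) (h~W t∈W) (h~W q∈W) s~q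
             (λ { refl → s≄t (inj₂ s~q) })
             (p-before s∈W (~⇒≢ p~s ∘ sym)) hst (p-before q∈W q≢p)

theorem5 : (G : Graph) → Connected G → Outer1Planar G →
    (CopWin G → Chordal G) × (Chordal G → CopWin G)
theorem5 G connected (pos , pos-inj , once) =
  copWin⇒chordal G (outer1Planar⇒¬wheel G pos pos-inj once) , chordal⇒copWin G connected
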